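{- Let $n\ge 2$ and suppose $T_1'$ and $T_2'$ are $n$-leaf binary trees with a common parse word. Let $1\le i\le n$. Let $T_1$ be obtained from $T_1'$ by attaching the $2$-leaf binary tree to leaf $i$, and let $T_2$ be obtained from $T_2'$ by duplicating leaf $i$. Then \[|\mathrm{ParseWords}(T_1, T_2)| = |\mathrm{ParseWords}(T_1', T_2')|.\] In particular, $T_1$ and $T_2$ have a common parse word.
   Context: A binary tree is a rooted ordered tree in which each vertex has either $0$ or $2$ children; its leaves are numbered $1,2,\dots$ from left to right. Let $G$ be the context-free grammar with start symbols $0,1,2$ and rules $0\to 12$, $0\to 21$, $1\to 02$, $1\to 20$, $2\to 01$, $2\to 10$. An $n$-leaf binary tree $T$ parses a word $w$ of length $n$ on $\{0,1,2\}$ if there is a labeling of the vertices of $T$ by $0,1,2$ such that the leaves, from left to right, are labeled with the letters of $w$, and at every internal vertex the label of the vertex together with the labels of its left and right children form a rule of $G$ (i.e. the three labels are pairwise distinct). A common parse word of two $n$-leaf trees is a word parsed by both. If $T$ parses $w$, it also parses every word obtained from $w$ by permuting the alphabet $\{0,1,2\}$. For $n$-leaf binary trees $T_1,T_2$, $\mathrm{ParseWords}(T_1,T_2)$ denotes the set of equivalence classes (under permutations of the alphabet $\{0,1,2\}$) of words parsed by both $T_1$ and $T_2$. Attaching the $2$-leaf binary tree to leaf $i$ means replacing leaf $i$ by an internal vertex whose two children are leaves. Duplicating leaf $i$ of a binary tree with at least two leaves: let $S$ be the subtree hanging from the sibling vertex of leaf $i$. Remove $S$, attach the $2$-leaf binary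 tree at the position of the sibling of leaf $i$, and reattach $S$ at the right leaf of the new $2$-leaf tree if leaf $i$ is a left child, and at the left leaf of the new $2$-leaf tree if leaf $i$ is a right child. That is, writing $(A,B)$ for the tree with left subtree $A$ and right subtree $B$ and $\bullet$ for a leaf, the subtree at the parent of leaf $i$ changes from $(\bullet,S)$ to $(\bullet,(\bullet,S))$ if leaf $i$ is a left leaf, and from $(S,\bullet)$ to $((S,\bullet),\bullet)$ if leaf $i$ is a right leaf. -}

module Defs where

open import Data.Fin using (Fin; splitAt)
open import Data.Fin.Patterns using (0F; 1F; 2F)
open import Data.Fin.Permutation as Perm using (Permutation′; _⟨$⟩ʳ_; _∘ₚ_; inverseˡ)
open import Data.List using (List; [_]; _++_; map)
open import Data.List.Properties using (map-id; map-∘; map-cong)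
open import Data.Nat using (ℕ; _+_; _≤_; s≤s)
open import Data.Product using (Σ; ∃; _×_; _,_; proj₁)
open import Data.Sum using ([_,_]′)
open import Data.Unit using (⊤)
open import Function using (_∘_)
open import Level using (0ℓ)
open import Relation.Binary using (Setoid)
import Relation.Binary.Construct.On as On
open import Relation.Binary.PropositionalEquality using (_≡_; refl; sym; trans)

infix 5 _∙_

data Tree : Set where
  •   : Tree
  _∙_ : Tree → Tree → Tree

leaves : Tree → ℕ
leaves •       = 1
leaves (l ∙ r) = leaves l + leaves r

data Vertex : Tree → Set where
  root  : ∀ {t} → Vertex t
  left  : ∀ {l r} → Vertex l → Vertex (l ∙ r)
  right : ∀ {l r} → Vertex r → Vertex (l ∙ r)

data Leaf : Tree → Set where
  here  : Leaf •
  left  : ∀ {l r} → Leaf l → Leaf (l ∙ r)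
  right : ∀ {l r} → Leaf r → Leaf (l ∙ r)

-- Leaves are numbered from left to right, starting from zero.
leafAt : ∀ t → Fin (leaves t) → Leaf t
leafAt •       _ = here
leafAt (l ∙ r) i = [ left ∘ leafAt l , right ∘ leafAt r ]′ (splitAt (leaves l) i)

nthLeaf : ∀ {n} t → leaves t ≡ n → Fin n → Leaf t
nthLeaf t refl i = leafAt t i

attach : ∀ t → Leaf t → Tree
attach •       here      = • ∙ •
attach (l ∙ r) (left x)  = attach l x ∙ r
attach (l ∙ r) (right x) = l ∙ attach r x

duplicateIn : ∀ l r → Leaf (l ∙ r) → Tree
duplicateIn •       s       (left here)  = • ∙ (• ∙ s)
duplicateIn s       •       (right here) = (s ∙ •) ∙ •
duplicateIn (a ∙ b) r       (left x)     = duplicateIn a b x ∙ r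
duplicateIn l       (a ∙ b) (right x)    = l ∙ duplicateIn a b x

duplicate : ∀ t → 2 ≤ leaves t → Leaf t → Tree
duplicate •       (s≤s ()) _
duplicate (l ∙ r) _        x = duplicateIn l r x

Letter : Set
Letter = Fin 3

Word : Set
Word = List Letter

infix 4 _⟶_▹_

data _⟶_▹_ : Letter → Letter → Letter → Set where
  0⟶12 : 0F ⟶ 1F ▹ 2F
  0⟶21 : 0F ⟶ 2F ▹ 1F
  1⟶02 : 1F ⟶ 0F ▹ 2F
  1⟶20 : 1F ⟶ 2F ▹ 0F
  2⟶01 : 2F ⟶ 0F ▹ 1F
  2⟶10 : 2F ⟶ 1F ▹ 0F

Labeling : Tree → Set
Labeling t = Vertex t → Letter

FollowsRules : ∀ t → Labeling t → Set
FollowsRules •       ℓ = ⊤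
FollowsRules (l ∙ r) ℓ =
  (ℓ root ⟶ ℓ (left root) ▹ ℓ (right root))
  × FollowsRules l (ℓ ∘ left)
  × FollowsRules r (ℓ ∘ right)

leafWord : ∀ t → Labeling t → Word
leafWord •       ℓ = [ ℓ root ]
leafWord (l ∙ r) ℓ = leafWord l (ℓ ∘ left) ++ leafWord r (ℓ ∘ right)

-- The root label is unconstrained because all three letters are start symbols.
Parses : Tree → Word → Set
Parses t w = Σ (Labeling t) λ ℓ → FollowsRules t ℓ × leafWord t ℓ ≡ w

IsCommonParseWord : Tree → Tree → Word → Set
IsCommonParseWord s t w = Parses s w × Parses t w

HaveCommonParseWord : Tree → Tree → Set
HaveCommonParseWord s t = ∃ (IsCommonParseWord s t)

infix 4 _∼_

_∼_ : Word → Word → Set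
v ∼ w = ∃ λ (π : Permutation′ 3) → map (π ⟨$⟩ʳ_) v ≡ w

∼-refl : ∀ {w} → w ∼ w
∼-refl {w} = Perm.id , map-id w

∼-sym : ∀ {v w} → v ∼ w → w ∼ v
∼-sym {v} (π , refl) = Perm.flip π ,
  trans (sym (map-∘ v)) (trans (map-cong (λ _ → inverseˡ π) v) (map-id v))

∼-trans : ∀ {u v w} → u ∼ v → v ∼ w → u ∼ w
∼-trans {u} (π , refl) (ρ , refl) = π ∘ₚ ρ , map-∘ u

wordSetoid : Setoid 0ℓ 0ℓ
wordSetoid = record
  { Carrier       = Word
  ; _≈_           = _∼_
  ; isEquivalence = record { refl = ∼-refl ; sym = ∼-sym ; trans = ∼-trans }
  }

-- The quotient is represented as a setoid, so that its cardinality is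
-- that of the set of classes.  The equality compares only the words and
-- ignores the parse labelings that witness membership.
ParseWords : Tree → Tree → Setoid 0ℓ 0ℓ
ParseWords s t = On.setoid {B = HaveCommonParseWord s t} wordSetoid proj₁

{-# OPTIONS --safe #-}

-- Attaching forces letters i, i+1 of a word to be distinct letters a, b; contracting
-- them to the third letter c gives a word parsed by T₁′.  In (•a, (•b, S)) the label
-- above S differs from both a and b, so it is c, the label of S is a and that of the
-- parent is b: the same labels parse (•c, S).  Conversely the labels of S and of the
-- parent in T₂′ dictate in which order a and b have to replace c.  Hence contraction
-- at i is a bijection, and it commutes with permutations of the alphabet.
module Submission where

open import Defs
open import Data.Fin using (Fin; toℕ; splitAt; _≟_)
open import Data.Fin.Patterns using (0F; 1F; 2F)
open import Data.Fin.Permutation using (Permutation′; _⟨$⟩ʳ_)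
open import Data.Fin.Properties using (splitAt⁻¹-↑ˡ; splitAt⁻¹-↑ʳ; toℕ-↑ˡ; toℕ-↑ʳ)
open import Data.List using ([]; _∷_; _++_; map)
open import Data.List.Properties using (++-assoc; ++-identityʳ)
open import Data.Nat using (ℕ; zero; suc; _+_; _≤_; s≤s)
open import Data.Nat.Properties using (+-assoc)
open import Data.Product using (∃; _×_; _,_; proj₁; proj₂)
open import Data.Sum using (inj₁; inj₂)
open import Data.Unit using (tt)
open import Function using (_∘_; flip)
open import Function.Bundles using (Inverse; module Injection)
open import Function.Properties.Inverse using (Inverse⇒Injection)
open import Relation.Binary.Core using (Rel)
open import Relation.Binary.PropositionalEquality
  using (_≡_; _≢_; refl; sym; trans; cong; subst)
open import Relation.Nullary.Decidable using (False; fromWitnessFalse)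
open import Level using (0ℓ)

private variable
  a b c x y z : Letter
  k n : ℕ
  t t′ l l′ r r′ : Tree
  u u′ v v′ w w′ : Word
  R S : Rel Word 0ℓ

-- The grammar rules

rule-distinct : x ⟶ y ▹ z → x ≢ y × y ≢ z × z ≢ x
rule-distinct 0⟶12 = (λ ()) , (λ ()) , (λ ())
rule-distinct 0⟶21 = (λ ()) , (λ ()) , (λ ())
rule-distinct 1⟶02 = (λ ()) , (λ ()) , (λ ())
rule-distinct 1⟶20 = (λ ()) , (λ ()) , (λ ())
rule-distinct 2⟶01 = (λ ()) , (λ ()) , (λ ())
rule-distinct 2⟶10 = (λ ()) , (λ ()) , (λ ())

-- Distinctness, unlike a list of rules, is visibly stable under permutations. On concrete letters
-- `False` computes, so coinciding letters give an empty hypothesis.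
distinct-rule : ∀ x y z → False (x ≟ y) → False (y ≟ z) → False (z ≟ x) → x ⟶ y ▹ z
distinct-rule 0F 1F 2F _ _ _ = 0⟶12
distinct-rule 0F 2F 1F _ _ _ = 0⟶21
distinct-rule 1F 0F 2F _ _ _ = 1⟶02
distinct-rule 1F 2F 0F _ _ _ = 1⟶20
distinct-rule 2F 0F 1F _ _ _ = 2⟶01
distinct-rule 2F 1F 0F _ _ _ = 2⟶10
distinct-rule 0F 2F 2F _ () _
distinct-rule 1F 2F 1F _ _ ()
distinct-rule 1F 2F 2F _ () _
distinct-rule 2F 0F 2F _ _ ()
distinct-rule 2F 1F 1F _ () _
distinct-rule 2F 1F 2F _ _ ()
distinct-rule 2F 2F _ () _ _

rule-permute : (π : Permutation′ 3) → x ⟶ y ▹ z → (π ⟨$⟩ʳ x) ⟶ (π ⟨$⟩ʳ y) ▹ (π ⟨$⟩ʳ z)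
rule-permute π ρ with rule-distinct ρ
... | x≢y , y≢z , z≢x = distinct-rule _ _ _
  (fromWitnessFalse (x≢y ∘ injective))
  (fromWitnessFalse (y≢z ∘ injective))
  (fromWitnessFalse (z≢x ∘ injective))
  where open Injection (Inverse⇒Injection π) using (injective)

rule-swap : x ⟶ y ▹ z → x ⟶ z ▹ y
rule-swap 0⟶12 = 0⟶21
rule-swap 0⟶21 = 0⟶12
rule-swap 1⟶02 = 1⟶20
rule-swap 1⟶20 = 1⟶02
rule-swap 2⟶01 = 2⟶10
rule-swap 2⟶10 = 2⟶01

rule-rotate : x ⟶ y ▹ z → y ⟶ z ▹ x
rule-rotate 0⟶12 = 1⟶20
rule-rotate 0⟶21 = 2⟶10
rule-rotate 1⟶02 = 0⟶21
rule-rotate 1⟶20 = 2⟶01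
rule-rotate 2⟶01 = 0⟶12
rule-rotate 2⟶10 = 1⟶02

rule-functional : x ⟶ a ▹ b → y ⟶ a ▹ b → x ≡ y
rule-functional 0⟶12 0⟶12 = refl
rule-functional 0⟶21 0⟶21 = refl
rule-functional 1⟶02 1⟶02 = refl
rule-functional 1⟶20 1⟶20 = refl
rule-functional 2⟶01 2⟶01 = refl
rule-functional 2⟶10 2⟶10 = refl

-- The label y, being different from a and b, is their third letter c.
rule-forced : c ⟶ a ▹ b → x ⟶ a ▹ y → y ⟶ b ▹ z → x ≡ b × y ≡ c × z ≡ a
rule-forced 0⟶12 2⟶10 0⟶21 = refl , refl , refl
rule-forced 0⟶21 1⟶20 0⟶12 = refl , refl , refl
rule-forced 1⟶02 2⟶01 1⟶20 = refl , refl , refl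
rule-forced 1⟶20 0⟶21 1⟶02 = refl , refl , refl
rule-forced 2⟶01 1⟶02 2⟶10 = refl , refl , refl
rule-forced 2⟶10 0⟶12 2⟶01 = refl , refl , refl

-- Parsing prefixes of words

-- Parse t x u v: with root label x, the tree t consumes a prefix of u and leaves v.
data Parse : Tree → Letter → Word → Word → Set where
  leaf : Parse • x (x ∷ v) v
  node : x ⟶ y ▹ z → Parse l y u v → Parse r z v w → Parse (l ∙ r) x u w

-- Labels are forced from the leaves upwards: two children leave only one letter for their parent.
parse-functional : Parse t x u v → Parse t y u w → x ≡ y × v ≡ w
parse-functional leaf leaf = refl , refl
parse-functional (node ρ p q) (node ρ′ p′ q′) with parse-functional p p′
... | refl , refl with parse-functional q q′
... | refl , refl = rule-functional ρ ρ′ , refl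

parse-permute : (π : Permutation′ 3) → Parse t x u v →
  Parse t (π ⟨$⟩ʳ x) (map (π ⟨$⟩ʳ_) u) (map (π ⟨$⟩ʳ_) v)
parse-permute π leaf         = leaf
parse-permute π (node ρ p q) = node (rule-permute π ρ) (parse-permute π p) (parse-permute π q)

labeling : Parse t x u v → Labeling t
labeling {x = x} _    root      = x
labeling (node _ p _) (left i)  = labeling p i
labeling (node _ _ q) (right i) = labeling q i

labeling-follows : (p : Parse t x u v) → FollowsRules t (labeling p)
labeling-follows leaf         = tt
labeling-follows (node ρ p q) = ρ , labeling-follows p , labeling-follows q

labeling-word : (p : Parse t x u v) → leafWord t (labeling p) ++ v ≡ u
labeling-word leaf = refl
labeling-word {t = l ∙ _} {v = v} (node _ p q) =
  trans (++-assoc (leafWord l (labeling p)) _ v)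
    (trans (cong (leafWord l (labeling p) ++_) (labeling-word q)) (labeling-word p))

parse⇒parses : Parse t x w [] → Parses t w
parse⇒parses p =
  labeling p , labeling-follows p , trans (sym (++-identityʳ _)) (labeling-word p)

-- The remainder `v` is arbitrary for the induction: what the left subtree leaves is the word of the
-- right one followed by `v`.
follows⇒parse : ∀ t (ℓ : Labeling t) → FollowsRules t ℓ → Parse t (ℓ root) (leafWord t ℓ ++ v) v
follows⇒parse •       ℓ _           = leaf
follows⇒parse {v} (l ∙ r) ℓ (ρ , f , g)
  rewrite ++-assoc (leafWord l (ℓ ∘ left)) (leafWord r (ℓ ∘ right)) v =
  node ρ (follows⇒parse l _ f) (follows⇒parse r _ g)

parses⇒parse : Parses t w → ∃ λ x → Parse t x w []
parses⇒parse {t} (ℓ , f , refl) =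
  ℓ root , subst (λ u → Parse t (ℓ root) u []) (++-identityʳ _) (follows⇒parse t ℓ f)

-- Relating words after a common prefix

-- Contraction changes the length of a word, so a position is fixed by peeling off equal letters
-- before it rather than by indexing.
data Under (R : Rel Word 0ℓ) : ℕ → Rel Word 0ℓ where
  zero : R u v → Under R zero u v
  suc  : Under R k u v → Under R (suc k) (x ∷ u) (x ∷ v)

under-flip : Under R k u v → Under (flip R) k v u
under-flip (zero ρ) = zero ρ
under-flip (suc ρ)  = suc (under-flip ρ)

under-span : Under R k u v → Under S k u w → Under (λ v w → ∃ λ u → R u v × S u w) k v w
under-span (zero ρ) (zero σ) = zero (_ , ρ , σ)
under-span (suc ρ)  (suc σ)  = suc (under-span ρ σ)

under-map : (f : Letter → Letter) → (∀ {u v} → R u v → R (map f u) (map f v)) →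
  Under R k u v → Under R k (map f u) (map f v)
under-map f h (zero ρ) = zero (h ρ)
under-map f h (suc ρ)  = suc (under-map f h ρ)

under-injective : (∀ {u v w} → R u w → R v w → u ≡ v) → Under R k u w → Under R k v w → u ≡ v
under-injective h (zero ρ) (zero σ) = h ρ σ
under-injective h (suc ρ)  (suc σ)  = cong (_ ∷_) (under-injective h ρ σ)

-- The last component: u and u′ agree on the prefix that t consumes.
parse-transport : Parse t x u v → Under R (leaves t + k) u u′ →
  ∃ λ v′ → Parse t x u′ v′ × Under R k v v′ × (v ≡ v′ → u ≡ u′)
parse-transport leaf (suc ρ) = _ , leaf , ρ , cong (_ ∷_)
parse-transport {t = l ∙ r} {k = k} (node g p q) ρ
  rewrite +-assoc (leaves l) (leaves r) k
  with parse-transport p ρ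
... | _ , p′ , ρ′ , e with parse-transport q ρ′
... | _ , q′ , ρ″ , e′ = _ , node g p′ q′ , ρ″ , e ∘ e′

parse-prepend : Parse t x u v → Under R k v v′ →
  ∃ λ u′ → Parse t x u′ v′ × Under R (leaves t + k) u u′
parse-prepend leaf ρ = _ , leaf , suc ρ
parse-prepend {t = l ∙ r} {k = k} (node g p q) ρ
  rewrite +-assoc (leaves l) (leaves r) k
  with parse-prepend q ρ
... | _ , q′ , ρ′ with parse-prepend p ρ′
... | _ , p′ , ρ″ = _ , node g p′ q′ , ρ″

-- Transferring parses between trees that differ in one subtree

-- Root label and remainder stay fixed, so the property passes to surrounding trees. Here the new
-- word is given; in `Lifts` it is produced from the parse.
Preserves : Rel Word 0ℓ → ℕ → Tree → Tree → Set
Preserves R k t t′ = ∀ {x u v u′} → Parse t x u v → Under R k u u′ → Parse t′ x u′ v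

Lifts : Rel Word 0ℓ → ℕ → Tree → Tree → Set
Lifts R k t t′ = ∀ {x u v} → Parse t x u v → ∃ λ u′ → Under R k u u′ × Parse t′ x u′ v

Separates : Rel Word 0ℓ → ℕ → Tree → Set
Separates R k t = ∀ {x y u u′ v v′} →
  Parse t x u v → Parse t y u′ v′ → Under R k u u′ → u ≡ u′

preserves-left : Preserves R k l l′ → Preserves R k (l ∙ r) (l′ ∙ r)
preserves-left h (node g p q) ρ = node g (h p ρ) q

preserves-right : Preserves R k r r′ → Preserves R (leaves l + k) (l ∙ r) (l ∙ r′)
preserves-right h (node g p q) ρ with parse-transport p ρ
... | _ , p′ , ρ′ , _ = node g p′ (h q ρ′)

lifts-left : Lifts R k l l′ → Lifts R k (l ∙ r) (l′ ∙ r)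
lifts-left h (node g p q) with h p
... | _ , ρ , p′ = _ , ρ , node g p′ q

lifts-right : Lifts R k r r′ → Lifts R (leaves l + k) (l ∙ r) (l ∙ r′)
lifts-right h (node g p q) with h q
... | _ , ρ , q′ with parse-prepend p ρ
... | _ , p′ , ρ′ = _ , ρ′ , node g p′ q′

separates-left : Separates R k l → Separates R k (l ∙ r)
separates-left h (node _ p _) (node _ p′ _) ρ = h p p′ ρ

separates-right : Separates R k r → Separates R (leaves l + k) (l ∙ r)
separates-right h (node _ p q) (node _ p′ q′) ρ with parse-transport p ρ
-- Both parses of the left subtree now read the second word, so they stop at the same remainder.
... | _ , p″ , ρ′ , e with parse-functional p′ p″
... | _ , refl = e (h q q′ ρ′)

-- Contraction

infix 4 _⇒_

data _⇒_ : Rel Word 0ℓ where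
  expand : c ⟶ a ▹ b → c ∷ v ⇒ a ∷ b ∷ v

⇒-injective : u ⇒ w → v ⇒ w → u ≡ v
⇒-injective (expand g) (expand g′) = cong (_∷ _) (rule-functional g g′)

⇒-permute : (π : Permutation′ 3) → u ⇒ v → map (π ⟨$⟩ʳ_) u ⇒ map (π ⟨$⟩ʳ_) v
⇒-permute π (expand g) = expand (rule-permute π g)

_⇐_ : Rel Word 0ℓ
_⇐_ = flip _⇒_

Siblings : Rel Word 0ℓ
Siblings v w = ∃ λ u → u ⇒ v × u ⇒ w

-- Attaching and duplicating at a numbered leaf.

position : Leaf t → ℕ
position here          = 0
position (left i)      = position i
position (right {l} i) = leaves l + position i

position-leafAt : ∀ t (i : Fin (leaves t)) → position (leafAt t i) ≡ toℕ i
position-leafAt •       0F = refl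
position-leafAt (l ∙ r) i with splitAt (leaves l) i in eq
... | inj₁ j = trans (position-leafAt l j)
  (trans (sym (toℕ-↑ˡ j (leaves r))) (cong toℕ (splitAt⁻¹-↑ˡ eq)))
... | inj₂ j = trans (cong (leaves l +_) (position-leafAt r j))
  (trans (sym (toℕ-↑ʳ (leaves l) j)) (cong toℕ (splitAt⁻¹-↑ʳ eq)))

position-nthLeaf : ∀ t (e : leaves t ≡ n) (i : Fin n) → position (nthLeaf t e i) ≡ toℕ i
position-nthLeaf t refl i = position-leafAt t i

-- The two records are complementary. An attached pair accepts either order of its letters, and its
-- parse yields their contraction; a duplicated leaf accepts that contraction, and its tree dictates
-- the order on expansion.
record Attachment (k : ℕ) (t t′ : Tree) : Set where
  field
    expands   : Preserves _⇒_ k t t′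
    contracts : Lifts _⇐_ k t′ t

record Duplication (k : ℕ) (t t′ : Tree) : Set where
  field
    expands   : Lifts _⇒_ k t t′
    contracts : Preserves _⇐_ k t′ t
    separates : Separates Siblings k t′

attachment : ∀ t (i : Leaf t) → Attachment (position i) t (attach t i)
attachment • here = record
  { expands   = λ { leaf (zero (expand g)) → node g leaf leaf }
  ; contracts = λ { (node g leaf leaf) → _ , zero (expand g) , leaf }
  }
attachment (l ∙ r) (left i) = record
  { expands   = preserves-left expands
  ; contracts = lifts-left contracts
  } where open Attachment (attachment l i)
attachment (l ∙ r) (right i) = record
  { expands   = preserves-right expands
  ; contracts = lifts-right contracts
  } where open Attachment (attachment r i)

duplication-left-leaf : Duplication 0 (• ∙ t) (• ∙ (• ∙ t))
duplication-left-leaf {t} = record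
  -- The letter of the leaf becomes the label of `t` followed by that of the parent; the old letter
  -- moves to the new internal vertex.
  { expands = λ { (node g leaf p) → _ , zero (expand (rule-rotate g))
      , node (rule-swap g) leaf (node (rule-swap (rule-rotate g)) leaf p) }
  ; contracts = contracts
  ; separates = separates
  }
  where
  contracts : Preserves _⇐_ 0 (• ∙ (• ∙ t)) (• ∙ t)
  contracts (node h leaf (node h′ leaf p)) (zero (expand g)) with rule-forced g h h′
  ... | refl , refl , refl = node (rule-rotate (rule-rotate g)) leaf p

  separates : Separates Siblings 0 (• ∙ (• ∙ t))
  separates (node h leaf (node h′ leaf p)) (node j leaf (node j′ leaf q))
            (zero (_ , expand g , expand g′))
    -- Both copies of `t` read the same letters, so they share a root label, which is the first new
    -- letter. The second is then the one distinct from it and from the contracted letter.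
    with parse-functional p q | rule-forced g h h′ | rule-forced g′ j j′
  ... | refl , _ | _ , _ , refl | _ , _ , refl =
    cong (λ b → _ ∷ b ∷ _)
      (rule-functional (rule-rotate (rule-rotate g)) (rule-rotate (rule-rotate g′)))

-- Mirror image of the previous case: the label of the parent now comes first and that of `t`
-- second. `rule-swap` reflects the rules so that `rule-forced` applies.
duplication-right-leaf : Duplication (leaves t + 0) (t ∙ •) ((t ∙ •) ∙ •)
duplication-right-leaf {t} = record
  { expands   = expands
  ; contracts = contracts
  ; separates = separates
  }
  where
  expands : Lifts _⇒_ (leaves t + 0) (t ∙ •) ((t ∙ •) ∙ •)
  expands (node g p leaf) with parse-prepend p (zero (expand (rule-rotate (rule-rotate g))))
  ... | _ , p′ , ρ =
    _ , ρ , node (rule-swap g) (node (rule-swap (rule-rotate (rule-rotate g))) p′ leaf) leaf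

  contracts : Preserves _⇐_ (leaves t + 0) ((t ∙ •) ∙ •) (t ∙ •)
  contracts (node h (node h′ p leaf) leaf) ρ with parse-transport p ρ
  ... | _ , p′ , zero (expand g) , _
    with rule-forced (rule-swap g) (rule-swap h) (rule-swap h′)
  ... | refl , refl , refl = node (rule-rotate g) p′ leaf

  separates : Separates Siblings (leaves t + 0) ((t ∙ •) ∙ •)
  separates (node h (node h′ p leaf) leaf) (node j (node j′ q leaf) leaf) ρ
    with parse-transport p ρ
  ... | _ , p′ , zero (_ , expand g , expand g′) , e with parse-functional q p′
  ... | refl , refl
    with rule-forced (rule-swap g) (rule-swap h) (rule-swap h′)
       | rule-forced (rule-swap g′) (rule-swap j) (rule-swap j′)
  ... | _ , _ , refl | _ , _ , refl =
    e (cong (λ a → a ∷ _ ∷ _) (rule-functional (rule-rotate g) (rule-rotate g′)))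

duplication-left : Duplication k l l′ → Duplication k (l ∙ r) (l′ ∙ r)
duplication-left δ = record
  { expands   = lifts-left expands
  ; contracts = preserves-left contracts
  ; separates = separates-left separates
  } where open Duplication δ

duplication-right : Duplication k r r′ → Duplication (leaves l + k) (l ∙ r) (l ∙ r′)
duplication-right δ = record
  { expands   = lifts-right expands
  ; contracts = preserves-right contracts
  ; separates = separates-right separates
  } where open Duplication δ

-- Right-hand sides repeat only because `duplicateIn` needs these case splits to unfold.
duplicationIn : ∀ l r (i : Leaf (l ∙ r)) →
  Duplication (position i) (l ∙ r) (duplicateIn l r i)
duplicationIn •       r       (left here)  = duplication-left-leaf
duplicationIn •       •       (right here) = duplication-right-leaf
duplicationIn (_ ∙ _) •       (right here) = duplication-right-leaf
duplicationIn (a ∙ b) •       (left i)     = duplication-left (duplicationIn a b i)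
duplicationIn (a ∙ b) (_ ∙ _) (left i)     = duplication-left (duplicationIn a b i)
duplicationIn •       (a ∙ b) (right i)    = duplication-right (duplicationIn a b i)
duplicationIn (_ ∙ _) (a ∙ b) (right i)    = duplication-right (duplicationIn a b i)

duplication : ∀ t (2≤t : 2 ≤ leaves t) (i : Leaf t) →
  Duplication (position i) t (duplicate t 2≤t i)
duplication •       (s≤s ()) _
duplication (l ∙ r) _        i = duplicationIn l r i

-- The bijection between classes of common parse words.

module _ {s s′ t t′ : Tree} (α : Attachment k s s′) (δ : Duplication k t t′) where
  private
    module α = Attachment α
    module δ = Duplication δ

  Contraction : Rel Word 0ℓ
  Contraction = Under _⇒_ k

  contract : ((w , _) : HaveCommonParseWord s′ t′) →
    ∃ λ ((u , _) : HaveCommonParseWord s t) → Contraction u w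
  contract (w , p , q) with parses⇒parse p | parses⇒parse q
  ... | _ , p′ | _ , q′ with α.contracts p′
  ... | u , ρ , p″ =
    (u , parse⇒parses p″ , parse⇒parses (δ.contracts q′ ρ)) , under-flip ρ

  expand-common : ((u , _) : HaveCommonParseWord s t) →
    ∃ λ ((w , _) : HaveCommonParseWord s′ t′) → Contraction u w
  expand-common (u , p , q) with parses⇒parse p | parses⇒parse q
  ... | _ , p′ | _ , q′ with δ.expands q′
  ... | w , ρ , q″ = (w , parse⇒parses (α.expands p′ ρ) , parse⇒parses q″) , ρ

  contraction-permute : (π : Permutation′ 3) → Contraction u w →
    Contraction (map (π ⟨$⟩ʳ_) u) (map (π ⟨$⟩ʳ_) w)
  contraction-permute π = under-map _ (⇒-permute π)

  -- The same permutation works: it carries contractions to contractions, and the expanded word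
  -- determines the contracted one.
  contraction-cong : Contraction u w → Contraction u′ w′ → w ∼ w′ → u ∼ u′
  contraction-cong ρ ρ′ (π , refl) =
    π , under-injective ⇒-injective (contraction-permute π ρ) ρ′

  -- After permuting, both words expand the same word at position `k`, and `t′` parses at most one
  -- such expansion.
  contraction-cancel : Parses t′ w → Parses t′ w′ →
    Contraction u w → Contraction u′ w′ → u ∼ u′ → w ∼ w′
  contraction-cancel p p′ ρ ρ′ (π , refl) with parses⇒parse p | parses⇒parse p′
  ... | _ , q | _ , q′ =
    π , δ.separates (parse-permute π q) q′ (under-span (contraction-permute π ρ) ρ′)

  -- Both maps stay within `Contraction`, so congruence and inverse laws are all instances of the
  -- two preceding lemmas.
  parseWords-inverse : Inverse (ParseWords s′ t′) (ParseWords s t)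
  parseWords-inverse = record
    { to        = to
    ; from      = from
    ; to-cong   = λ {v} {w} → contraction-cong (proj₂ (contract v)) (proj₂ (contract w))
    ; from-cong = λ {v} {w} → cancel (from v) (from w)
        (proj₂ (expand-common v)) (proj₂ (expand-common w))
    ; inverse   =
        (λ {u} {w} → contraction-cong (proj₂ (contract w)) (proj₂ (expand-common u)))
      , (λ {w} {u} → cancel (from u) w (proj₂ (expand-common u)) (proj₂ (contract w)))
    }
    where
    to : HaveCommonParseWord s′ t′ → HaveCommonParseWord s t
    to w = proj₁ (contract w)

    from : HaveCommonParseWord s t → HaveCommonParseWord s′ t′
    from u = proj₁ (expand-common u)

    cancel : ((w , _) (w′ , _) : HaveCommonParseWord s′ t′) →
      Contraction u w → Contraction u′ w′ → u ∼ u′ → w ∼ w′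
    cancel (_ , _ , p) (_ , _ , p′) = contraction-cancel p p′

proposition11 : ∀ (n : ℕ) (2≤n : 2 ≤ n) (T₁′ T₂′ : Tree) (e₁ : leaves T₁′ ≡ n) (e₂ : leaves T₂′ ≡ n) →
    HaveCommonParseWord T₁′ T₂′ →
    (i : Fin n) →
    let T₁ = attach T₁′ (nthLeaf T₁′ e₁ i)
        T₂ = duplicate T₂′ (subst (2 ≤_) (sym e₂) 2≤n) (nthLeaf T₂′ e₂ i)
    in Inverse (ParseWords T₁ T₂) (ParseWords T₁′ T₂′) × HaveCommonParseWord T₁ T₂
proposition11 n 2≤n T₁′ T₂′ e₁ e₂ common i = inverse , Inverse.from inverse common
  where
  x₁ = nthLeaf T₁′ e₁ i
  x₂ = nthLeaf T₂′ e₂ i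
  2≤leaves = subst (2 ≤_) (sym e₂) 2≤n
  -- Both leaves sit at position `toℕ i`, so the attachment and the duplication act on the same
  -- letter of a word.
  α = subst (λ k → Attachment k T₁′ (attach T₁′ x₁))
        (position-nthLeaf T₁′ e₁ i) (attachment T₁′ x₁)
  δ = subst (λ k → Duplication k T₂′ (duplicate T₂′ 2≤leaves x₂))
        (position-nthLeaf T₂′ e₂ i) (duplication T₂′ 2≤leaves x₂)
  inverse = parseWords-inverse α δ
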